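{- Let $q$ be a prime power. If $\mathcal{F} \subset \mathrm{GL}_2(\mathbb{F}_q)$ is a maximal intersecting set, then $\mathcal{F}$ is a maximum intersecting set.
   Context: $\mathrm{GL}_2(\mathbb{F}_q)$ acts by left multiplication on $\Omega_q := \mathbb{F}_q^2\setminus\{0\}$. A subset $\mathcal{F}\subset \mathrm{GL}_2(\mathbb{F}_q)$ is intersecting if for all $A,B\in\mathcal{F}$ there exists $u\in\Omega_q$ with $Au=Bu$. An intersecting set is maximal if it is not properly contained in another intersecting set of $\mathrm{GL}_2(\mathbb{F}_q)$; it is maximum if it has the largest cardinality among all intersecting sets of $\mathrm{GL}_2(\mathbb{F}_q)$. -}

module Defs where

open import Algebra.Bundles using (CommutativeRing)
import Algebra.Definitions as AlgDefs
import Algebra.Properties.Monoid.Sum as Sum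
open import Data.Bool.Base using (if_then_else_)
open import Data.Fin.Base using (Fin)
open import Data.Fin.Properties using (_≟_)
open import Data.Nat.Base using (ℕ; _^_; _≤_)
open import Data.Nat.Primality using (Prime)
open import Data.Product.Base using (Σ; ∃; ∃₂; _×_; proj₁)
open import Data.Vec.Functional using (Vector)
import Data.Vec.Functional.Relation.Binary.Equality.Setoid as VecEq
open import Function.Bundles using (Inverse)
open import Level using (Level; _⊔_; suc)
open import Relation.Binary.Bundles using (Setoid)
import Relation.Binary.Construct.On as On
open import Relation.Binary.Definitions using (_Respects_)
open import Relation.Binary.PropositionalEquality using (_≡_)
import Relation.Binary.PropositionalEquality as ≡
open import Relation.Nullary.Decidable using (does)
open import Relation.Nullary.Negation using (¬_)
open import Relation.Unary using (Pred; _⊂_)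

PrimePower : ℕ → Set
PrimePower q = ∃₂ λ p k → Prime p × 1 ≤ k × q ≡ p ^ k

HasCardinality : ∀ {a ℓ} → Setoid a ℓ → ℕ → Set (a ⊔ ℓ)
HasCardinality S n = Inverse (≡.setoid (Fin n)) S

record Field (c ℓ : Level) : Set (suc (c ⊔ ℓ)) where
  field
    commutativeRing : CommutativeRing c ℓ

  open CommutativeRing commutativeRing public
  open AlgDefs _≈_ using (Invertible)

  field
    0≉1        : ¬ (0# ≈ 1#)
    invertible : ∀ {x} → ¬ (x ≈ 0#) → Invertible 1# _*_ x

module LinearAlgebra {c ℓ} (K : Field c ℓ) where

  open Field K
  open Sum +-monoid using (sum)
  open VecEq setoid using (_≋_; ≋-setoid)

  Matrix : ℕ → Set c
  Matrix n = Vector (Vector Carrier n) n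

  matrixSetoid : ℕ → Setoid c ℓ
  matrixSetoid n = VecEq.≋-setoid (≋-setoid n) n

  infixl 7 _*ₘ_
  infixr 7 _*ᵥ_

  _*ₘ_ : ∀ {n} → Matrix n → Matrix n → Matrix n
  (A *ₘ B) i k = sum λ j → A i j * B j k

  _*ᵥ_ : ∀ {n} → Matrix n → Vector Carrier n → Vector Carrier n
  (A *ᵥ u) i = sum λ j → A i j * u j

  0ᵥ : ∀ {n} → Vector Carrier n
  0ᵥ _ = 0#

  1ₘ : ∀ {n} → Matrix n
  1ₘ i j = if does (i ≟ j) then 1# else 0#

  GL : ℕ → Set (c ⊔ ℓ)
  GL n = Σ (Matrix n) λ A → Invertible 1ₘ _*ₘ_ A
    where open AlgDefs (Setoid._≈_ (matrixSetoid n)) using (Invertible)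

  -- Elements of GL are compared as matrices, ignoring the invertibility proof.
  GLSetoid : ℕ → Setoid (c ⊔ ℓ) ℓ
  GLSetoid n = On.setoid {B = GL n} (matrixSetoid n) proj₁

  Ω : ℕ → Set (c ⊔ ℓ)
  Ω n = Σ (Vector Carrier n) λ u → ¬ (u ≋ 0ᵥ)

  -- A subset of GL n together with its cardinality.  Over a finite field every
  -- subset is classically of this form; constructively, carrying `card` and
  -- `enumeration` makes membership decidable and the cardinality available.
  record Subset (n : ℕ) : Set (suc (c ⊔ ℓ)) where
    field
      member   : Pred (GL n) (c ⊔ ℓ)
      respects : member Respects (Setoid._≈_ (GLSetoid n))

    memberSetoid : Setoid (c ⊔ ℓ) ℓ
    memberSetoid = On.setoid {B = Σ (GL n) member} (GLSetoid n) proj₁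

    field
      card        : ℕ
      enumeration : HasCardinality memberSetoid card

  open Subset public using (member; card)

  Intersecting : ∀ {n} → Subset n → Set (c ⊔ ℓ)
  Intersecting {n} F = ∀ A B → member F A → member F B →
    ∃ λ (u : Ω n) → proj₁ A *ᵥ proj₁ u ≋ proj₁ B *ᵥ proj₁ u

  Maximal : ∀ {n} → Subset n → Set (suc (c ⊔ ℓ))
  Maximal {n} F = Intersecting F ×
    ¬ (∃ λ (G : Subset n) → Intersecting G × member F ⊂ member G)

  Maximum : ∀ {n} → Subset n → Set (suc (c ⊔ ℓ))
  Maximum {n} F = Intersecting F ×
    (∀ (G : Subset n) → Intersecting G → card G ≤ card F)

{-# OPTIONS --safe #-}

-- Two elements A, B of GL₂ agree at a nonzero vector exactly when det (A - B) = 0.  A family of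
-- 2 × 2 matrices with pairwise singular differences, normalised to contain 0, either has a common
-- kernel vector, or its transposes do: take a nonzero member X₁ with kernel spanned by u and
-- image spanned by x.  Polarising det forces X u ∥ x for every member X, and as soon as some
-- X u ≠ 0 it forces every member to have its image in the line spanned by x.
--
-- So every intersecting set lies in some {A ∈ GL₂ | A u = w} or the transpose of such a set.
-- These sets are intersecting and all have q (q - 1) elements: with u, u′ and w, w′ bases of
-- determinant one, A is determined by A u′ = b w + d w′, and det A = d.  A maximal intersecting
-- set therefore is one of them, and no intersecting set is larger.
module Submission where

open import Defs
open import Level using (Level; _⊔_; Lift; lift; lower)
open import Data.Nat.Base using (ℕ; _≤_)
open import Algebra.Bundles using (CommutativeRing)
import Algebra.Properties.AbelianGroup
import Algebra.Properties.Ring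
import Algebra.Properties.Semiring.Mult
import Algebra.Solver.Ring
open import Algebra.Solver.Ring.AlmostCommutativeRing using (fromCommutativeRing; _-Raw-AlmostCommutative⟶_)
open import Data.Fin.Base using (Fin; punchIn; punchOut)
open import Data.Fin.Patterns using (0F; 1F)
open import Data.Fin.Properties
  using (any?; _≟_; *↔×; injective⇒≤; punchInᵢ≢i; punchIn-punchOut; punchOut-punchIn; punchOut-cong)
open import Data.Integer.Base as ℤ using (ℤ; +_; -[1+_]; 0ℤ; _⊖_)
import Data.Integer.Properties as ℤ
open import Data.Maybe.Base as Maybe using (Maybe)
open import Data.Nat.Base as ℕ using (zero; suc)
open import Data.Nat.Properties using (_≤?_; ≤-trans; ≤-reflexive)
open import Data.Product.Base using (∃; _×_; _,_; proj₁; proj₂)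
open import Data.Sum.Base using (_⊎_; inj₁; inj₂; map₁)
open import Data.Vec.Functional using (Vector)
import Data.Vec.Functional.Relation.Binary.Equality.Setoid as VecEq
open import Function.Bundles using (Inverse)
open import Relation.Binary.Definitions using (Decidable)
open import Relation.Binary.PropositionalEquality using (_≡_)
import Relation.Binary.PropositionalEquality as ≡
open import Relation.Nullary.Decidable
  using (Dec; yes; no; ¬?; map′; decidable-stable; dec⇒maybe; _×-dec_)
open import Relation.Nullary.Negation using (¬_; contradiction)
open import Relation.Unary using (_⊆_)

-- Polynomial identities over a commutative ring.

-- Integer coefficients let the solver cancel x - x over an abstract ring.
module IntegerRingSolver {c ℓ} (R : CommutativeRing c ℓ) where
  open CommutativeRing R
  open Algebra.Properties.Ring ring using (-0#≈0#; -‿involutive; -‿distribˡ-*; -‿distribʳ-*)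
  open Algebra.Properties.AbelianGroup +-abelianGroup using (xyx⁻¹≈y; ⁻¹-∙-comm)
  open Algebra.Properties.Semiring.Mult semiring using (×-homo-+; ×1-homo-*) renaming (_×_ to infixr 8 _·_)
  open import Relation.Binary.Reasoning.Setoid setoid

  ⟦_⟧ : ℤ → Carrier
  ⟦ + n ⟧      = n · 1#
  ⟦ -[1+ n ] ⟧ = - (suc n · 1#)

  neg-homo : ∀ i → ⟦ ℤ.- i ⟧ ≈ - ⟦ i ⟧
  neg-homo (+ zero)  = sym -0#≈0#
  neg-homo (+ suc n) = refl
  neg-homo -[1+ n ]  = sym (-‿involutive _)

  -- By induction, removing a unit from both arguments; in the ring this amounts to inserting `1#`
  -- and its negative.
  ⊖-homo : ∀ m n → ⟦ m ⊖ n ⟧ ≈ m · 1# - n · 1#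
  ⊖-homo m zero = begin
    m · 1#      ≈⟨ +-identityʳ _ ⟨
    m · 1# + 0# ≈⟨ +-congˡ -0#≈0# ⟨
    m · 1# - 0# ∎
  ⊖-homo zero (suc n) = sym (+-identityˡ _)
  ⊖-homo (suc m) (suc n) = begin
    ⟦ suc m ⊖ suc n ⟧                       ≡⟨ ≡.cong ⟦_⟧ (ℤ.[1+m]⊖[1+n]≡m⊖n m n) ⟩
    ⟦ m ⊖ n ⟧                               ≈⟨ ⊖-homo m n ⟩
    m · 1# - n · 1#                         ≈⟨ +-congʳ (xyx⁻¹≈y 1# (m · 1#)) ⟨
    (1# + m · 1# + - 1#) - n · 1#           ≈⟨ +-assoc _ _ _ ⟩
    (1# + m · 1#) + (- 1# - n · 1#)         ≈⟨ +-congˡ (⁻¹-∙-comm _ _) ⟩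
    (1# + m · 1#) - (1# + n · 1#)           ∎

  +-homo : ∀ i j → ⟦ i ℤ.+ j ⟧ ≈ ⟦ i ⟧ + ⟦ j ⟧
  +-homo (+ m)    (+ n)    = ×-homo-+ 1# m n
  +-homo (+ m)    -[1+ n ] = ⊖-homo m (suc n)
  +-homo -[1+ m ] (+ n)    = trans (⊖-homo n (suc m)) (+-comm _ _)
  +-homo -[1+ m ] -[1+ n ] = begin
    ⟦ -[1+ m ] ℤ.+ -[1+ n ] ⟧              ≡⟨ ≡.cong ⟦_⟧ (ℤ.neg-distrib-+ (+ suc m) (+ suc n)) ⟨
    - ((suc m ℕ.+ suc n) · 1#)             ≈⟨ -‿cong (×-homo-+ 1# (suc m) (suc n)) ⟩
    - (suc m · 1# + suc n · 1#)            ≈⟨ ⁻¹-∙-comm _ _ ⟨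
    - (suc m · 1#) - suc n · 1#            ∎

  *-homo⁺ : ∀ m j → ⟦ + m ℤ.* j ⟧ ≈ ⟦ + m ⟧ * ⟦ j ⟧
  *-homo⁺ m (+ n) = begin
    ⟦ + m ℤ.* + n ⟧                ≡⟨ ≡.cong ⟦_⟧ (ℤ.pos-* m n) ⟨
    (m ℕ.* n) · 1#                 ≈⟨ ×1-homo-* m n ⟩
    m · 1# * n · 1#                ∎
  *-homo⁺ m -[1+ n ] = begin
    ⟦ + m ℤ.* -[1+ n ] ⟧           ≡⟨ ≡.cong ⟦_⟧ (ℤ.neg-distribʳ-* (+ m) (+ suc n)) ⟨
    ⟦ ℤ.- (+ m ℤ.* + suc n) ⟧      ≈⟨ neg-homo (+ m ℤ.* + suc n) ⟩
    - ⟦ + m ℤ.* + suc n ⟧          ≈⟨ -‿cong (*-homo⁺ m (+ suc n)) ⟩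
    - (m · 1# * (suc n · 1#))      ≈⟨ -‿distribʳ-* _ _ ⟩
    m · 1# * - (suc n · 1#)        ∎

  *-homo : ∀ i j → ⟦ i ℤ.* j ⟧ ≈ ⟦ i ⟧ * ⟦ j ⟧
  *-homo (+ m)    j = *-homo⁺ m j
  *-homo -[1+ m ] j = begin
    ⟦ -[1+ m ] ℤ.* j ⟧             ≡⟨ ≡.cong ⟦_⟧ (ℤ.neg-distribˡ-* (+ suc m) j) ⟨
    ⟦ ℤ.- (+ suc m ℤ.* j) ⟧        ≈⟨ neg-homo (+ suc m ℤ.* j) ⟩
    - ⟦ + suc m ℤ.* j ⟧            ≈⟨ -‿cong (*-homo⁺ (suc m) j) ⟩
    - (suc m · 1# * ⟦ j ⟧)         ≈⟨ -‿distribˡ-* _ _ ⟩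
    - (suc m · 1#) * ⟦ j ⟧         ∎

  homomorphism : ℤ.+-*-rawRing -Raw-AlmostCommutative⟶ fromCommutativeRing R
  homomorphism = record
    { ⟦_⟧    = ⟦_⟧
    ; +-homo = +-homo
    ; *-homo = *-homo
    ; -‿homo = neg-homo
    ; 0-homo = refl
    ; 1-homo = +-identityʳ 1#
    }

  coefficientsAgree? : ∀ i j → Maybe (⟦ i ⟧ ≈ ⟦ j ⟧)
  coefficientsAgree? i j = Maybe.map (λ i≡j → reflexive (≡.cong ⟦_⟧ i≡j)) (dec⇒maybe (i ℤ.≟ j))

  open Algebra.Solver.Ring ℤ.+-*-rawRing (fromCommutativeRing R) homomorphism coefficientsAgree? public
    using (Polynomial; solve; con; _:=_; _:+_; _:*_; _:-_; :-_)

-- Vectors in the plane over a field with decidable equality.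

module Plane {c ℓ} (K : Field c ℓ) (_≈?_ : Decidable (Field._≈_ K)) where
  open Field K
  open LinearAlgebra K
  open VecEq setoid using (_≋_)
  open IntegerRingSolver commutativeRing using (Polynomial; solve; con; _:=_; _:+_; _:*_; _:-_; :-_)
  open Algebra.Properties.Ring ring using (-0#≈0#; -‿involutive)
  open Algebra.Properties.AbelianGroup +-abelianGroup using (x≈y⇒x∙y⁻¹≈ε; x∙y⁻¹≈ε⇒x≈y)
  open import Relation.Binary.Reasoning.Setoid setoid

  V : Set c
  V = Vector Carrier 2

  infix  8 _∧_
  infix  8 _∙_
  infixl 6 _-ᵥ_ _-ₘ_
  infix  9 _ᵀ

  -- The determinant with columns `x` and `y`. It vanishes exactly on dependent pairs; the value
  -- `1#` marks a basis whose coordinate formulas need no denominators.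
  _∧_ : V → V → Carrier
  x ∧ y = x 0F * y 1F - x 1F * y 0F

  -- The trailing `0#` makes `A i ∙ u` definitionally equal to `(A *ᵥ u) i`.
  _∙_ : V → V → Carrier
  x ∙ y = x 0F * y 0F + (x 1F * y 1F + 0#)

  _-ᵥ_ : V → V → V
  (x -ᵥ y) i = x i - y i

  _-ₘ_ : Matrix 2 → Matrix 2 → Matrix 2
  (A -ₘ B) i = A i -ᵥ B i

  _ᵀ : Matrix 2 → Matrix 2
  (A ᵀ) i j = A j i

  det : Matrix 2 → Carrier
  det A = (A ᵀ) 0F ∧ (A ᵀ) 1F

  private
    infix  8 _:∧_
    infix  8 _:∙_

    _:∧_ : ∀ {n} → Vector (Polynomial n) 2 → Vector (Polynomial n) 2 → Polynomial n
    x :∧ y = x 0F :* y 1F :- x 1F :* y 0F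

    _:∙_ : ∀ {n} → Vector (Polynomial n) 2 → Vector (Polynomial n) 2 → Polynomial n
    x :∙ y = x 0F :* y 0F :+ (x 1F :* y 1F :+ con 0ℤ)

    ⟨_,_⟩ : ∀ {a} {A : Set a} → A → A → Vector A 2
    ⟨ a , b ⟩ 0F = a
    ⟨ a , b ⟩ 1F = b

  ∧-cong : ∀ {x x′ y y′} → x ≋ x′ → y ≋ y′ → x ∧ y ≈ x′ ∧ y′
  ∧-cong x≋ y≋ = +-cong (*-cong (x≋ 0F) (y≋ 1F)) (-‿cong (*-cong (x≋ 1F) (y≋ 0F)))

  ∧-zeroˡ : ∀ {x} y → x ≋ 0ᵥ → x ∧ y ≈ 0#
  ∧-zeroˡ {x} y x≋0 = trans (∧-cong {x} {0ᵥ} {y} x≋0 (λ _ → refl))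
    (solve 2 (λ y₀ y₁ → con 0ℤ :* y₁ :- con 0ℤ :* y₀ := con 0ℤ) refl (y 0F) (y 1F))

  ∧-anticomm-zero : ∀ x y → x ∧ y ≈ 0# → y ∧ x ≈ 0#
  ∧-anticomm-zero x y x∧y≈0 = begin
    y ∧ x        ≈⟨ solve 4 (λ x₀ x₁ y₀ y₁ →
      let x = ⟨ x₀ , x₁ ⟩ ; y = ⟨ y₀ , y₁ ⟩ in
      y :∧ x := :- (x :∧ y)) refl (x 0F) (x 1F) (y 0F) (y 1F) ⟩
    - (x ∧ y)    ≈⟨ -‿cong x∧y≈0 ⟩
    - 0#         ≈⟨ -0#≈0# ⟩
    0#           ∎

  ∙-zeroˡ : ∀ {x} y → x ≋ 0ᵥ → x ∙ y ≈ 0#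
  ∙-zeroˡ y x≋0 = trans (+-cong (*-congʳ (x≋0 0F)) (+-congʳ (*-congʳ (x≋0 1F))))
    (solve 2 (λ y₀ y₁ → ⟨ con 0ℤ , con 0ℤ ⟩ :∙ ⟨ y₀ , y₁ ⟩ := con 0ℤ) refl (y 0F) (y 1F))

  ∧-self : ∀ x → x ∧ x ≈ 0#
  ∧-self x = solve 2 (λ x₀ x₁ → ⟨ x₀ , x₁ ⟩ :∧ ⟨ x₀ , x₁ ⟩ := con 0ℤ) refl (x 0F) (x 1F)

  -- Cramer's rule, `(z ∧ t) x = (x ∧ t) z + (z ∧ x) t`, wedged with `y`.
  plücker : ∀ x y z t → (z ∧ t) * (x ∧ y) ≈ (x ∧ t) * (z ∧ y) + (z ∧ x) * (t ∧ y)
  plücker x y z t = solve 8 (λ x₀ x₁ y₀ y₁ z₀ z₁ t₀ t₁ →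
    let x = ⟨ x₀ , x₁ ⟩ ; y = ⟨ y₀ , y₁ ⟩ ; z = ⟨ z₀ , z₁ ⟩ ; t = ⟨ t₀ , t₁ ⟩ in
    (z :∧ t) :* (x :∧ y) := (x :∧ t) :* (z :∧ y) :+ (z :∧ x) :* (t :∧ y)) refl
    (x 0F) (x 1F) (y 0F) (y 1F) (z 0F) (z 1F) (t 0F) (t 1F)

  ≋0? : (x : V) → Dec (x ≋ 0ᵥ)
  ≋0? x with x 0F ≈? 0# | x 1F ≈? 0#
  ... | no x₀≉0  | _        = no λ x≋0 → x₀≉0 (x≋0 0F)
  ... | yes _    | no x₁≉0  = no λ x≋0 → x₁≉0 (x≋0 1F)
  ... | yes x₀≈0 | yes x₁≈0 = yes λ { 0F → x₀≈0 ; 1F → x₁≈0 }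

  complement : ∀ {x} → ¬ (x ≋ 0ᵥ) → ∃ λ y → x ∧ y ≈ 1#
  complement {x} x≉0 with x 0F ≈? 0# | x 1F ≈? 0#
  ... | yes x₀≈0 | yes x₁≈0 = contradiction (λ { 0F → x₀≈0 ; 1F → x₁≈0 }) x≉0
  ... | no x₀≉0  | _        = let a , _ , x₀a≈1 = invertible x₀≉0 in
    ⟨ 0# , a ⟩ ,
    trans (solve 3 (λ x₀ x₁ a → ⟨ x₀ , x₁ ⟩ :∧ ⟨ con 0ℤ , a ⟩ := x₀ :* a) refl (x 0F) (x 1F) a) x₀a≈1
  ... | yes _    | no x₁≉0  = let a , _ , x₁a≈1 = invertible x₁≉0 in
    ⟨ - a , 0# ⟩ ,
    trans (solve 3 (λ x₀ x₁ a → ⟨ x₀ , x₁ ⟩ :∧ ⟨ :- a , con 0ℤ ⟩ := x₁ :* a) refl (x 0F) (x 1F) a) x₁a≈1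

  -- Choosing `t` with `z ∧ t ≈ 1#`, the Plücker relation writes `x ∧ y` as a combination of `z ∧ x`
  -- and `z ∧ y`.
  parallel-trans : ∀ x y {z} → ¬ (z ≋ 0ᵥ) → z ∧ x ≈ 0# → z ∧ y ≈ 0# → x ∧ y ≈ 0#
  parallel-trans x y {z} z≉0 z∧x≈0 z∧y≈0 = let t , z∧t≈1 = complement z≉0 in begin
    x ∧ y                                     ≈⟨ *-identityˡ _ ⟨
    1# * (x ∧ y)                              ≈⟨ *-congʳ z∧t≈1 ⟨
    (z ∧ t) * (x ∧ y)                         ≈⟨ plücker x y z t ⟩
    (x ∧ t) * (z ∧ y) + (z ∧ x) * (t ∧ y)     ≈⟨ +-cong (*-congˡ z∧y≈0) (*-congʳ z∧x≈0) ⟩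
    (x ∧ t) * 0# + 0# * (t ∧ y)               ≈⟨ +-cong (zeroʳ _) (zeroˡ _) ⟩
    0# + 0#                                   ≈⟨ +-identityˡ 0# ⟩
    0#                                        ∎

  -- Cramer's rule for a row vector known on a basis. Applied to each row, it shows that a matrix is
  -- determined by its values on `u` and `v`.
  covector : ∀ y u v → u ∧ v ≈ 1# → ∀ {a b} → y ∙ u ≈ a → y ∙ v ≈ b →
             y 0F ≈ a * v 1F - b * u 1F × y 1F ≈ b * u 0F - a * v 0F
  covector y u v u∧v≈1 {a} {b} y∙u≈a y∙v≈b = eq₀ , eq₁
    where
    eq₀ : y 0F ≈ a * v 1F - b * u 1F
    eq₀ = begin
      y 0F                                ≈⟨ *-identityˡ _ ⟨
      1# * y 0F                           ≈⟨ *-congʳ u∧v≈1 ⟨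
      (u ∧ v) * y 0F                      ≈⟨ solve 6 (λ y₀ y₁ u₀ u₁ v₀ v₁ →
        let y = ⟨ y₀ , y₁ ⟩ ; u = ⟨ u₀ , u₁ ⟩ ; v = ⟨ v₀ , v₁ ⟩ in
        (u :∧ v) :* y₀ := (y :∙ u) :* v₁ :- (y :∙ v) :* u₁) refl
        (y 0F) (y 1F) (u 0F) (u 1F) (v 0F) (v 1F) ⟩
      (y ∙ u) * v 1F - (y ∙ v) * u 1F     ≈⟨ +-cong (*-congʳ y∙u≈a) (-‿cong (*-congʳ y∙v≈b)) ⟩
      a * v 1F - b * u 1F                 ∎
    eq₁ : y 1F ≈ b * u 0F - a * v 0F
    eq₁ = begin
      y 1F                                ≈⟨ *-identityˡ _ ⟨
      1# * y 1F                           ≈⟨ *-congʳ u∧v≈1 ⟨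
      (u ∧ v) * y 1F                      ≈⟨ solve 6 (λ y₀ y₁ u₀ u₁ v₀ v₁ →
        let y = ⟨ y₀ , y₁ ⟩ ; u = ⟨ u₀ , u₁ ⟩ ; v = ⟨ v₀ , v₁ ⟩ in
        (u :∧ v) :* y₁ := (y :∙ v) :* u₀ :- (y :∙ u) :* v₀) refl
        (y 0F) (y 1F) (u 0F) (u 1F) (v 0F) (v 1F) ⟩
      (y ∙ v) * u 0F - (y ∙ u) * v 0F     ≈⟨ +-cong (*-congʳ y∙v≈b) (-‿cong (*-congʳ y∙u≈a)) ⟩
      b * u 0F - a * v 0F                 ∎

  covector-zero : ∀ {y} u v → u ∧ v ≈ 1# → y ∙ u ≈ 0# → y ∙ v ≈ 0# → y ≋ 0ᵥ
  covector-zero {y} u v u∧v≈1 y∙u≈0 y∙v≈0 = λ { 0F → trans (proj₁ eqs) vanish ; 1F → trans (proj₂ eqs) vanish }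
    where
    eqs = covector y u v u∧v≈1 y∙u≈0 y∙v≈0
    vanish : ∀ {a b} → 0# * a - 0# * b ≈ 0#
    vanish = solve 2 (λ a b → con 0ℤ :* a :- con 0ℤ :* b := con 0ℤ) refl _ _

  -- Determinants, kernels and agreement of matrices.

  -- Multiplicativity of the determinant, with `x` and `y` as columns of the second factor.
  det-*ᵥ : ∀ A x y → (A *ᵥ x) ∧ (A *ᵥ y) ≈ det A * (x ∧ y)
  det-*ᵥ A x y = solve 8 (λ a b c d x₀ x₁ y₀ y₁ →
    let x = ⟨ x₀ , x₁ ⟩ ; y = ⟨ y₀ , y₁ ⟩ ; r = ⟨ a , b ⟩ ; s = ⟨ c , d ⟩ in
    ⟨ r :∙ x , s :∙ x ⟩ :∧ ⟨ r :∙ y , s :∙ y ⟩ := (⟨ a , c ⟩ :∧ ⟨ b , d ⟩) :* (x :∧ y)) refl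
    (A 0F 0F) (A 0F 1F) (A 1F 0F) (A 1F 1F) (x 0F) (x 1F) (y 0F) (y 1F)

  -ₘ-*ᵥ : ∀ A B x → (A -ₘ B) *ᵥ x ≋ A *ᵥ x -ᵥ B *ᵥ x
  -ₘ-*ᵥ A B x i = solve 6 (λ a b c d x₀ x₁ →
    let x = ⟨ x₀ , x₁ ⟩ in
    ⟨ a :- c , b :- d ⟩ :∙ x := ⟨ a , b ⟩ :∙ x :- ⟨ c , d ⟩ :∙ x) refl
    (A i 0F) (A i 1F) (B i 0F) (B i 1F) (x 0F) (x 1F)

  e₀ : Ω 2
  e₀ = ⟨ 1# , 0# ⟩ , λ e₀≋0 → 0≉1 (sym (e₀≋0 0F))

  -- A nonzero row (a, b) kills (b, -a), and the other row sends this vector to the determinant up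
  -- to sign. For the zero matrix `e₀` is a default.
  kernel : ∀ A → det A ≈ 0# → ∃ λ (u : Ω 2) → A *ᵥ proj₁ u ≋ 0ᵥ
  kernel A det≈0 with ≋0? (A 0F) | ≋0? (A 1F)
  ... | yes A₀≋0 | yes A₁≋0 = e₀ , λ { 0F → ∙-zeroˡ (proj₁ e₀) A₀≋0 ; 1F → ∙-zeroˡ (proj₁ e₀) A₁≋0 }
  ... | no A₀≉0 | _ = (⟨ A 0F 1F , - A 0F 0F ⟩ , λ u≋0 → A₀≉0 λ
        { 0F → trans (sym (-‿involutive _)) (trans (-‿cong (u≋0 1F)) -0#≈0#) ; 1F → u≋0 0F })
    , λ { 0F → solve 2 (λ a b → ⟨ a , b ⟩ :∙ ⟨ b , :- a ⟩ := con 0ℤ) refl (A 0F 0F) (A 0F 1F)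
        ; 1F → trans (solve 4 (λ a b c d → ⟨ c , d ⟩ :∙ ⟨ b , :- a ⟩ := :- (⟨ a , c ⟩ :∧ ⟨ b , d ⟩)) refl
                 (A 0F 0F) (A 0F 1F) (A 1F 0F) (A 1F 1F)) (trans (-‿cong det≈0) -0#≈0#) }
  ... | _ | no A₁≉0 = (⟨ A 1F 1F , - A 1F 0F ⟩ , λ u≋0 → A₁≉0 λ
        { 0F → trans (sym (-‿involutive _)) (trans (-‿cong (u≋0 1F)) -0#≈0#) ; 1F → u≋0 0F })
    , λ { 1F → solve 2 (λ a b → ⟨ a , b ⟩ :∙ ⟨ b , :- a ⟩ := con 0ℤ) refl (A 1F 0F) (A 1F 1F)
        ; 0F → trans (solve 4 (λ a b c d → ⟨ a , b ⟩ :∙ ⟨ d , :- c ⟩ := ⟨ a , c ⟩ :∧ ⟨ b , d ⟩) refl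
                 (A 0F 0F) (A 0F 1F) (A 1F 0F) (A 1F 1F)) det≈0 }

  *ᵥ-cong : ∀ {A B : Matrix 2} x → (∀ i → A i ≋ B i) → A *ᵥ x ≋ B *ᵥ x
  *ᵥ-cong x A≋B i = +-cong (*-congʳ (A≋B i 0F)) (+-congʳ (*-congʳ (A≋B i 1F)))

  det-cong : ∀ {A B : Matrix 2} → (∀ i → A i ≋ B i) → det A ≈ det B
  det-cong A≋B = ∧-cong (λ i → A≋B i 0F) (λ i → A≋B i 1F)

  det-ᵀ : ∀ A → det (A ᵀ) ≈ det A
  det-ᵀ A = +-congˡ (-‿cong (*-comm _ _))

  kernel⇒agree : ∀ A B u → (A -ₘ B) *ᵥ u ≋ 0ᵥ → A *ᵥ u ≋ B *ᵥ u
  kernel⇒agree A B u Xu≋0 i = x∙y⁻¹≈ε⇒x≈y _ _ (trans (sym (-ₘ-*ᵥ A B u i)) (Xu≋0 i))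

  -- Evaluated on a basis `u`, `v` of determinant one, `det (A -ₘ B)` is the wedge of the images of
  -- `u` and `v`, the first of which is zero.
  agree⇒det≈0 : ∀ A B (u : Ω 2) → A *ᵥ proj₁ u ≋ B *ᵥ proj₁ u → det (A -ₘ B) ≈ 0#
  agree⇒det≈0 A B (u , u≉0) Au≋Bu = let v , u∧v≈1 = complement u≉0 in begin
    det (A -ₘ B)                             ≈⟨ *-identityʳ _ ⟨
    det (A -ₘ B) * 1#                        ≈⟨ *-congˡ u∧v≈1 ⟨
    det (A -ₘ B) * (u ∧ v)                   ≈⟨ det-*ᵥ (A -ₘ B) u v ⟨
    ((A -ₘ B) *ᵥ u) ∧ ((A -ₘ B) *ᵥ v)        ≈⟨ ∧-zeroˡ ((A -ₘ B) *ᵥ v) (λ i → trans (-ₘ-*ᵥ A B u i) (x≈y⇒x∙y⁻¹≈ε (Au≋Bu i))) ⟩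
    0#                                       ∎

  det≈0⇒agree : ∀ A B → det (A -ₘ B) ≈ 0# → ∃ λ (u : Ω 2) → A *ᵥ proj₁ u ≋ B *ᵥ proj₁ u
  det≈0⇒agree A B det≈0 = let u , Xu≋0 = kernel (A -ₘ B) det≈0 in
    u , kernel⇒agree A B (proj₁ u) Xu≋0

  -- `(X *ᵥ u) ∧ (X *ᵥ v)` is a quadratic form in `X`, a multiple of `det X`. The left side is its
  -- polar form: the value at `X` plus that at `Y` minus that at `X -ₘ Y`.
  det-polar : ∀ X Y u v → det X ≈ 0# → det Y ≈ 0# → det (X -ₘ Y) ≈ 0# →
              (X *ᵥ u) ∧ (Y *ᵥ v) + (Y *ᵥ u) ∧ (X *ᵥ v) ≈ 0#
  det-polar X Y u v X≈0 Y≈0 X-Y≈0 = begin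
    (X *ᵥ u) ∧ (Y *ᵥ v) + (Y *ᵥ u) ∧ (X *ᵥ v)
      ≈⟨ expand (X *ᵥ u) (X *ᵥ v) (Y *ᵥ u) (Y *ᵥ v) ⟩
    (X *ᵥ u) ∧ (X *ᵥ v) + (Y *ᵥ u) ∧ (Y *ᵥ v) - (X *ᵥ u -ᵥ Y *ᵥ u) ∧ (X *ᵥ v -ᵥ Y *ᵥ v)
      ≈⟨ +-cong (+-cong (vanish X X≈0) (vanish Y Y≈0)) (-‿cong
         (trans (sym (∧-cong (-ₘ-*ᵥ X Y u) (-ₘ-*ᵥ X Y v))) (vanish (X -ₘ Y) X-Y≈0))) ⟩
    0# + 0# - 0#
      ≈⟨ solve 0 (con 0ℤ :+ con 0ℤ :- con 0ℤ := con 0ℤ) refl ⟩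
    0# ∎
    where
    vanish : ∀ Z → det Z ≈ 0# → (Z *ᵥ u) ∧ (Z *ᵥ v) ≈ 0#
    vanish Z Z≈0 = trans (det-*ᵥ Z u v) (trans (*-congʳ Z≈0) (zeroˡ _))
    expand : ∀ x y z t → x ∧ t + z ∧ y ≈ x ∧ y + z ∧ t - (x -ᵥ z) ∧ (y -ᵥ t)
    expand x y z t = solve 8 (λ x₀ x₁ y₀ y₁ z₀ z₁ t₀ t₁ →
      let x = ⟨ x₀ , x₁ ⟩ ; y = ⟨ y₀ , y₁ ⟩ ; z = ⟨ z₀ , z₁ ⟩ ; t = ⟨ t₀ , t₁ ⟩ in
      x :∧ t :+ z :∧ y := x :∧ y :+ z :∧ t :- ⟨ x₀ :- z₀ , x₁ :- z₁ ⟩ :∧ ⟨ y₀ :- t₀ , y₁ :- t₁ ⟩) refl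
      (x 0F) (x 1F) (y 0F) (y 1F) (z 0F) (z 1F) (t 0F) (t 1F)

  -- Families of singular matrices with singular differences.

  module SingularFamily {n} (X : Fin n → Matrix 2)
    (singular : ∀ i → det (X i) ≈ 0#) (singular₂ : ∀ i j → det (X i -ₘ X j) ≈ 0#) where

    -- Coordinates adapted to a nonzero member: `u` spans the kernel of `X i₁` and `x` spans its
    -- image.
    module Basis {i₁} {u v} (u∧v≈1 : u ∧ v ≈ 1#) (X₁u≋0 : X i₁ *ᵥ u ≋ 0ᵥ) (X₁v≉0 : ¬ (X i₁ *ᵥ v ≋ 0ᵥ)) where

      x : V
      x = X i₁ *ᵥ v

      polar : ∀ i j → (X i *ᵥ u) ∧ (X j *ᵥ v) + (X j *ᵥ u) ∧ (X i *ᵥ v) ≈ 0#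
      polar i j = det-polar (X i) (X j) u v (singular i) (singular j) (singular₂ i j)

      -- One polar term disappears when `X j` kills `u`. For `j = i₁` this confines `X i *ᵥ u` to
      -- the line of `x`.
      polar-zero : ∀ i j → X j *ᵥ u ≋ 0ᵥ → (X i *ᵥ u) ∧ (X j *ᵥ v) ≈ 0#
      polar-zero i j Xⱼu≋0 = begin
        (X i *ᵥ u) ∧ (X j *ᵥ v)                                ≈⟨ +-identityʳ _ ⟨
        (X i *ᵥ u) ∧ (X j *ᵥ v) + 0#                           ≈⟨ +-congˡ (∧-zeroˡ (X i *ᵥ v) Xⱼu≋0) ⟨
        (X i *ᵥ u) ∧ (X j *ᵥ v) + (X j *ᵥ u) ∧ (X i *ᵥ v)      ≈⟨ polar i j ⟩
        0#                                                     ∎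

      diagonal : ∀ i → (X i *ᵥ u) ∧ (X i *ᵥ v) ≈ 0#
      diagonal i = trans (det-*ᵥ (X i) u v) (trans (*-congʳ (singular i)) (zeroˡ _))

      Xu∥x : ∀ i → (X i *ᵥ u) ∧ x ≈ 0#
      Xu∥x i = polar-zero i i₁ X₁u≋0

      -- If `X j` kills `u`, polarising against `X i` makes `X j *ᵥ v` parallel to the nonzero
      -- `X i *ᵥ u`. Otherwise singularity of `X j` makes it parallel to the nonzero `X j *ᵥ u`.
      -- Both of these lie on the line of `x`.
      image∥x : ∀ i → ¬ (X i *ᵥ u ≋ 0ᵥ) → ∀ j → x ∧ (X j *ᵥ v) ≈ 0#
      image∥x i Xᵢu≉0 j with ≋0? (X j *ᵥ u)
      ... | yes Xⱼu≋0 = parallel-trans x (X j *ᵥ v) Xᵢu≉0 (Xu∥x i) (polar-zero i j Xⱼu≋0)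
      ... | no Xⱼu≉0  = parallel-trans x (X j *ᵥ v) Xⱼu≉0 (Xu∥x j) (diagonal j)

      dichotomy : (∀ i → X i *ᵥ u ≋ 0ᵥ) ⊎ (∃ λ (w : Ω 2) → ∀ i → (X i) ᵀ *ᵥ proj₁ w ≋ 0ᵥ)
      dichotomy with any? (λ i → ¬? (≋0? (X i *ᵥ u)))
      ... | no allZero       = inj₁ λ i → decidable-stable (≋0? (X i *ᵥ u)) (λ Xᵢu≉0 → allZero (i , Xᵢu≉0))
      ... | yes (i , Xᵢu≉0)  = inj₂ (w , λ j → covector-zero u v u∧v≈1
              (trans (adjoint (X j) u) (∧-anticomm-zero (X j *ᵥ u) x (Xu∥x j)))
              (trans (adjoint (X j) v) (image∥x i Xᵢu≉0 j)))
        where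
        -- This is `x` turned by a right angle, so pairing it with `y` gives `x ∧ y`. As all images
        -- lie on the line of `x`, every transpose kills it.
        w : Ω 2
        w = ⟨ - x 1F , x 0F ⟩ , λ w≋0 → X₁v≉0 λ
          { 0F → w≋0 1F ; 1F → trans (sym (-‿involutive _)) (trans (-‿cong (w≋0 0F)) -0#≈0#) }
        adjoint : ∀ A y → (A ᵀ *ᵥ proj₁ w) ∙ y ≈ x ∧ (A *ᵥ y)
        adjoint A y = solve 8 (λ a b c d x₀ x₁ y₀ y₁ →
          let w = ⟨ :- x₁ , x₀ ⟩ ; y = ⟨ y₀ , y₁ ⟩ in
          ⟨ ⟨ a , c ⟩ :∙ w , ⟨ b , d ⟩ :∙ w ⟩ :∙ y := ⟨ x₀ , x₁ ⟩ :∧ ⟨ ⟨ a , b ⟩ :∙ y , ⟨ c , d ⟩ :∙ y ⟩) refl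
          (A 0F 0F) (A 0F 1F) (A 1F 0F) (A 1F 1F) (x 0F) (x 1F) (y 0F) (y 1F)

    commonKernel : (∃ λ (u : Ω 2) → ∀ i → X i *ᵥ proj₁ u ≋ 0ᵥ) ⊎
                   (∃ λ (w : Ω 2) → ∀ i → (X i) ᵀ *ᵥ proj₁ w ≋ 0ᵥ)
    commonKernel with any? (λ i → ¬? (≋0? (X i 0F) ×-dec ≋0? (X i 1F)))
    -- All members vanish, so any nonzero vector would do.
    ... | no allZero = inj₁ (e₀ , λ i →
            let X₀≋0 , X₁≋0 = decidable-stable (≋0? (X i 0F) ×-dec ≋0? (X i 1F)) (λ X≉0 → allZero (i , X≉0)) in
            λ { 0F → ∙-zeroˡ (proj₁ e₀) X₀≋0 ; 1F → ∙-zeroˡ (proj₁ e₀) X₁≋0 })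
    ... | yes (i₁ , X₁≉0) = let (u , u≉0) , X₁u≋0 = kernel (X i₁) (singular i₁) ; v , u∧v≈1 = complement u≉0 in
      map₁ (λ Xu≋0 → (u , u≉0) , Xu≋0)
        (Basis.dichotomy {i₁} {u} {v} u∧v≈1 X₁u≋0
          -- Were `X i₁ *ᵥ v` zero too, both rows of `X i₁` would vanish on a basis, contrary to the
          -- choice of `i₁`.
          (λ X₁v≋0 → X₁≉0 (covector-zero u v u∧v≈1 (X₁u≋0 0F) (X₁v≋0 0F) , covector-zero u v u∧v≈1 (X₁u≋0 1F) (X₁v≋0 1F))))

  -- Invertibility and the determinant.

  det-1ₘ : det 1ₘ ≈ 1#
  -- `1#` enters as a variable, since the solver interprets the integer one as `1# + 0#`.
  det-1ₘ = trans (solve 1 (λ a → ⟨ a , con 0ℤ ⟩ :∧ ⟨ con 0ℤ , a ⟩ := a :* a) refl 1#) (*-identityˡ 1#)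

  GL⇒det≉0 : (A : GL 2) → ¬ (det (proj₁ A) ≈ 0#)
  GL⇒det≉0 (A , B , _ , AB≈1) det≈0 = 0≉1 (begin
    0#               ≈⟨ zeroˡ _ ⟨
    0# * det B       ≈⟨ *-congʳ det≈0 ⟨
    det A * det B    ≈⟨ det-*ᵥ A ((B ᵀ) 0F) ((B ᵀ) 1F) ⟨
    det (A *ₘ B)     ≈⟨ det-cong AB≈1 ⟩
    det 1ₘ           ≈⟨ det-1ₘ ⟩
    1#               ∎)

  -- The inverse `B` is the adjugate scaled by the inverse `δ` of the determinant.
  det≉0⇒GL : ∀ A → ¬ (det A ≈ 0#) → GL 2
  det≉0⇒GL A det≉0 = A , B ,
    (λ { 0F 0F → trans (solve 5 (λ p q r s δ → ⟨ δ :* s , :- (δ :* q) ⟩ :∙ ⟨ p , r ⟩ := δ :* (p :* s :- r :* q)) refl p q r s δ) δdet≈1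
       ; 0F 1F → solve 5 (λ p q r s δ → ⟨ δ :* s , :- (δ :* q) ⟩ :∙ ⟨ q , s ⟩ := con 0ℤ) refl p q r s δ
       ; 1F 0F → solve 5 (λ p q r s δ → ⟨ :- (δ :* r) , δ :* p ⟩ :∙ ⟨ p , r ⟩ := con 0ℤ) refl p q r s δ
       ; 1F 1F → trans (solve 5 (λ p q r s δ → ⟨ :- (δ :* r) , δ :* p ⟩ :∙ ⟨ q , s ⟩ := δ :* (p :* s :- r :* q)) refl p q r s δ) δdet≈1 }) ,
    (λ { 0F 0F → trans (solve 5 (λ p q r s δ → ⟨ p , q ⟩ :∙ ⟨ δ :* s , :- (δ :* r) ⟩ := δ :* (p :* s :- r :* q)) refl p q r s δ) δdet≈1
       ; 0F 1F → solve 5 (λ p q r s δ → ⟨ p , q ⟩ :∙ ⟨ :- (δ :* q) , δ :* p ⟩ := con 0ℤ) refl p q r s δ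
       ; 1F 0F → solve 5 (λ p q r s δ → ⟨ r , s ⟩ :∙ ⟨ δ :* s , :- (δ :* r) ⟩ := con 0ℤ) refl p q r s δ
       ; 1F 1F → trans (solve 5 (λ p q r s δ → ⟨ r , s ⟩ :∙ ⟨ :- (δ :* q) , δ :* p ⟩ := δ :* (p :* s :- r :* q)) refl p q r s δ) δdet≈1 })
    where
    p = A 0F 0F
    q = A 0F 1F
    r = A 1F 0F
    s = A 1F 1F
    δ = proj₁ (invertible det≉0)
    δdet≈1 = proj₁ (proj₂ (invertible det≉0))
    B : Matrix 2
    B 0F = ⟨ δ * s , - (δ * q) ⟩
    B 1F = ⟨ - (δ * r) , δ * p ⟩

  GL-injective : (A : GL 2) → ∀ {u} → ¬ (u ≋ 0ᵥ) → ¬ (proj₁ A *ᵥ u ≋ 0ᵥ)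
  GL-injective A {u} u≉0 Au≋0 = let v , u∧v≈1 = complement u≉0 in GL⇒det≉0 A (begin
    det (proj₁ A)                           ≈⟨ *-identityʳ _ ⟨
    det (proj₁ A) * 1#                      ≈⟨ *-congˡ u∧v≈1 ⟨
    det (proj₁ A) * (u ∧ v)                 ≈⟨ det-*ᵥ (proj₁ A) u v ⟨
    (proj₁ A *ᵥ u) ∧ (proj₁ A *ᵥ v)         ≈⟨ ∧-zeroˡ (proj₁ A *ᵥ v) Au≋0 ⟩
    0#                                      ∎)

  -- Transposed subsets and comparison of cardinalities.

  transpose : GL 2 → GL 2
  transpose A = det≉0⇒GL (proj₁ A ᵀ) (λ det≈0 → GL⇒det≉0 A (trans (sym (det-ᵀ (proj₁ A))) det≈0))

  infix 9 _ᵀˢ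

  _ᵀˢ : Subset 2 → Subset 2
  F ᵀˢ = record
    { member      = λ A → member F (transpose A)
    ; respects    = λ A≈B → respects (λ i j → A≈B j i)
    ; card        = card F
    ; enumeration = record
      -- Transposing twice restores the matrix but not the invertibility proof, so `respects`
      -- carries membership over.
      { to        = λ k → let A , A∈F = to k in transpose A , respects (λ i j → refl) A∈F
      ; from      = λ (A , A∈F) → from (transpose A , A∈F)
      ; to-cong   = λ { ≡.refl i j → refl }
      ; from-cong = λ A≈B → from-cong (λ i j → A≈B j i)
      ; inverse   = (λ y≈from i j → inverseˡ y≈from j i) , (λ y≈to → inverseʳ (λ i j → y≈to j i))
      }
    }
    where
    open Subset F using (respects; enumeration)
    open Inverse enumeration

  -- Agreement at a nonzero vector means a singular difference, a condition stable under
  -- transposition even though the witnessing vector may change.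
  ᵀˢ-intersecting : ∀ F → Intersecting F → Intersecting (F ᵀˢ)
  ᵀˢ-intersecting F F-int A B A∈ B∈ =
    let u , agree = F-int (transpose A) (transpose B) A∈ B∈ in
    det≈0⇒agree (proj₁ A) (proj₁ B) (trans (sym (det-ᵀ (proj₁ A -ₘ proj₁ B)))
      (agree⇒det≈0 (proj₁ A ᵀ) (proj₁ B ᵀ) u agree))

  card-mono : ∀ (F H : Subset 2) → member F ⊆ member H → card F ≤ card H
  card-mono F H F⊆H = injective⇒≤ {f = f} f-injective
    where
    module F = Inverse (Subset.enumeration F)
    module H = Inverse (Subset.enumeration H)
    include : ∃ (member F) → ∃ (member H)
    include (A , A∈F) = A , F⊆H A∈F
    f : Fin (card F) → Fin (card H)
    f k = H.from (include (F.to k))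
    f-injective : ∀ {j k} → f j ≡ f k → j ≡ k
    f-injective {j} {k} fj≡fk = ≡.trans (≡.sym (F.strictlyInverseʳ j)) (F.inverseʳ λ i l →
      trans (sym (H.strictlyInverseˡ (include (F.to j)) i l)) (H.inverseˡ fj≡fk i l))

-- The sets of invertible matrices with `A u = w` over a field of q = `suc m` elements.

module FinitePlane {c ℓ} (K : Field c ℓ) {m} (finite : HasCardinality (Field.setoid K) (suc m)) where
  open Field K hiding (zero)
  open LinearAlgebra K
  open VecEq setoid using (_≋_)
  open IntegerRingSolver commutativeRing using (solve; con; _:=_; _:+_; _:*_; _:-_)
  open import Relation.Binary.Reasoning.Setoid setoid
  module K = Inverse finite

  _≈?_ : Decidable _≈_
  x ≈? y = map′ (λ eq → trans (sym (K.strictlyInverseˡ x)) (K.inverseˡ eq)) K.from-cong (K.from x ≟ K.from y)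

  open Plane K _≈?_

  -- The matrix sending the basis (u , u′) of determinant one to (w , z).
  interpolate : (u u′ w z : V) → Matrix 2
  interpolate u u′ w z i 0F = w i * u′ 1F - z i * u 1F
  interpolate u u′ w z i 1F = z i * u 0F - w i * u′ 0F

  interpolate-*ᵥ : ∀ u u′ w z x i → (interpolate u u′ w z *ᵥ x) i ≈ (x ∧ u′) * w i + (u ∧ x) * z i
  interpolate-*ᵥ u u′ w z x i = solve 8 (λ u₀ u₁ v₀ v₁ x₀ x₁ w z →
    (w :* v₁ :- z :* u₁) :* x₀ :+ ((z :* u₀ :- w :* v₀) :* x₁ :+ con 0ℤ) :=
    (x₀ :* v₁ :- x₁ :* v₀) :* w :+ (u₀ :* x₁ :- u₁ :* x₀) :* z) refl
    (u 0F) (u 1F) (u′ 0F) (u′ 1F) (x 0F) (x 1F) (w i) (z i)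

  -- Two invertible matrices sending `u` to `w` differ by an element of the stabiliser of `u`, hence
  -- the name. The vectors `u′` and `w′` provide coordinates for counting.
  module Coset (u u′ w w′ : V) (u∧u′≈1 : u ∧ u′ ≈ 1#) (w∧w′≈1 : w ∧ w′ ≈ 1#) where

    interpolate-u : ∀ z → interpolate u u′ w z *ᵥ u ≋ w
    interpolate-u z i = begin
      (interpolate u u′ w z *ᵥ u) i          ≈⟨ interpolate-*ᵥ u u′ w z u i ⟩
      (u ∧ u′) * w i + (u ∧ u) * z i         ≈⟨ +-cong (*-congʳ u∧u′≈1) (*-congʳ (∧-self u)) ⟩
      1# * w i + 0# * z i                    ≈⟨ +-cong (*-identityˡ _) (zeroˡ _) ⟩
      w i + 0#                               ≈⟨ +-identityʳ _ ⟩
      w i                                    ∎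

    interpolate-u′ : ∀ z → interpolate u u′ w z *ᵥ u′ ≋ z
    interpolate-u′ z i = begin
      (interpolate u u′ w z *ᵥ u′) i         ≈⟨ interpolate-*ᵥ u u′ w z u′ i ⟩
      (u′ ∧ u′) * w i + (u ∧ u′) * z i       ≈⟨ +-cong (*-congʳ (∧-self u′)) (*-congʳ u∧u′≈1) ⟩
      0# * w i + 1# * z i                    ≈⟨ +-cong (zeroˡ _) (*-identityˡ _) ⟩
      0# + z i                               ≈⟨ +-identityˡ _ ⟩
      z i                                    ∎

    interpolate-unique : ∀ A {z} → A *ᵥ u ≋ w → A *ᵥ u′ ≋ z → ∀ i j → interpolate u u′ w z i j ≈ A i j
    interpolate-unique A Au≋w Au′≋z i 0F = sym (proj₁ (covector (A i) u u′ u∧u′≈1 (Au≋w i) (Au′≋z i)))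
    interpolate-unique A Au≋w Au′≋z i 1F = sym (proj₂ (covector (A i) u u′ u∧u′≈1 (Au≋w i) (Au′≋z i)))

    -- Identifies the determinant with the coordinate along `w′` of the image of `u′`, turning
    -- invertibility into a nonzero coordinate.
    det-via-images : ∀ A → A *ᵥ u ≋ w → det A ≈ w ∧ (A *ᵥ u′)
    det-via-images A Au≋w = begin
      det A                         ≈⟨ *-identityʳ _ ⟨
      det A * 1#                    ≈⟨ *-congˡ u∧u′≈1 ⟨
      det A * (u ∧ u′)              ≈⟨ det-*ᵥ A u u′ ⟨
      (A *ᵥ u) ∧ (A *ᵥ u′)          ≈⟨ ∧-cong {y = A *ᵥ u′} {A *ᵥ u′} Au≋w (λ _ → refl) ⟩
      w ∧ (A *ᵥ u′)                 ∎

    -- The letters w, w′ belong to the operator name: b w+ d w′ is the vector b w + d w′.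
    infix 9 _w+_w′
    _w+_w′ : Carrier → Carrier → V
    (b w+ d w′) i = b * w i + d * w′ i

    ∧-w′ : ∀ b d → (b w+ d w′) ∧ w′ ≈ b
    ∧-w′ b d = begin
      (b w+ d w′) ∧ w′              ≈⟨ solve 6 (λ b d w₀ w₁ v₀ v₁ →
        (b :* w₀ :+ d :* v₀) :* v₁ :- (b :* w₁ :+ d :* v₁) :* v₀ := b :* (w₀ :* v₁ :- w₁ :* v₀)) refl
        b d (w 0F) (w 1F) (w′ 0F) (w′ 1F) ⟩
      b * (w ∧ w′)                  ≈⟨ *-congˡ w∧w′≈1 ⟩
      b * 1#                        ≈⟨ *-identityʳ b ⟩
      b                             ∎

    w-∧ : ∀ b d → w ∧ (b w+ d w′) ≈ d
    w-∧ b d = begin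
      w ∧ (b w+ d w′)               ≈⟨ solve 6 (λ b d w₀ w₁ v₀ v₁ →
        w₀ :* (b :* w₁ :+ d :* v₁) :- w₁ :* (b :* w₀ :+ d :* v₀) := d :* (w₀ :* v₁ :- w₁ :* v₀)) refl
        b d (w 0F) (w 1F) (w′ 0F) (w′ 1F) ⟩
      d * (w ∧ w′)                  ≈⟨ *-congˡ w∧w′≈1 ⟩
      d * 1#                        ≈⟨ *-identityʳ d ⟩
      d                             ∎

    coordinates : ∀ z → (z ∧ w′) w+ (w ∧ z) w′ ≋ z
    coordinates z i = begin
      (z ∧ w′) * w i + (w ∧ z) * w′ i    ≈⟨ identity i ⟩
      (w ∧ w′) * z i                     ≈⟨ *-congʳ w∧w′≈1 ⟩
      1# * z i                           ≈⟨ *-identityˡ _ ⟩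
      z i                                ∎
      where
      identity : ∀ i → (z ∧ w′) * w i + (w ∧ z) * w′ i ≈ (w ∧ w′) * z i
      identity 0F = solve 6 (λ z₀ z₁ w₀ w₁ v₀ v₁ →
        (z₀ :* v₁ :- z₁ :* v₀) :* w₀ :+ (w₀ :* z₁ :- w₁ :* z₀) :* v₀ := (w₀ :* v₁ :- w₁ :* v₀) :* z₀) refl
        (z 0F) (z 1F) (w 0F) (w 1F) (w′ 0F) (w′ 1F)
      identity 1F = solve 6 (λ z₀ z₁ w₀ w₁ v₀ v₁ →
        (z₀ :* v₁ :- z₁ :* v₀) :* w₁ :+ (w₀ :* z₁ :- w₁ :* z₀) :* v₁ := (w₀ :* v₁ :- w₁ :* v₀) :* z₁) refl
        (z 0F) (z 1F) (w 0F) (w 1F) (w′ 0F) (w′ 1F)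

    -- `i` indexes all scalars. `punchIn` skips the index of `0#`, so `j` indexes the nonzero ones,
    -- which are the possible determinants.
    matrixAt : Fin (suc m) × Fin m → Matrix 2
    matrixAt (i , j) = interpolate u u′ w (K.to i w+ K.to (punchIn (K.from 0#) j) w′)

    matrixAt-det : ∀ p → ¬ (det (matrixAt p) ≈ 0#)
    matrixAt-det (i , j) det≈0 = punchInᵢ≢i (K.from 0#) j
      (≡.sym (≡.trans (K.from-cong (sym d≈0)) (K.strictlyInverseʳ d)))
      where
      d = punchIn (K.from 0#) j
      z = K.to i w+ K.to d w′
      d≈0 : K.to d ≈ 0#
      d≈0 = begin
        K.to d                                      ≈⟨ w-∧ _ _ ⟨
        w ∧ z                                       ≈⟨ ∧-cong {w} {w} (λ _ → refl) (interpolate-u′ z) ⟨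
        w ∧ (interpolate u u′ w z *ᵥ u′)            ≈⟨ det-via-images (interpolate u u′ w z) (interpolate-u z) ⟨
        det (interpolate u u′ w z)                  ≈⟨ det≈0 ⟩
        0#                                          ∎

    from≢0 : ∀ {x} → ¬ (x ≈ 0#) → ¬ (K.from 0# ≡ K.from x)
    from≢0 {x} x≉0 eq = x≉0 (trans (sym (K.strictlyInverseˡ x)) (K.inverseˡ (≡.sym eq)))

    -- `Lift` reaches the universe level required of `member`.
    Member : GL 2 → Set (c ⊔ ℓ)
    Member A = Lift c (proj₁ A *ᵥ u ≋ w)

    w∧image≉0 : (A : ∃ Member) → ¬ (w ∧ (proj₁ (proj₁ A) *ᵥ u′) ≈ 0#)
    w∧image≉0 (A , lift Au≋w) ≈0 = GL⇒det≉0 A (trans (det-via-images (proj₁ A) Au≋w) ≈0)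

    -- Reads off the coordinates of the image of `u′`. The second is the determinant, so its index
    -- differs from that of `0#` and `punchOut` applies.
    position : ∃ Member → Fin (suc m) × Fin m
    position A = K.from ((proj₁ (proj₁ A) *ᵥ u′) ∧ w′) , punchOut (from≢0 (w∧image≉0 A))

    position-cong : ∀ A B → (∀ i j → proj₁ (proj₁ A) i j ≈ proj₁ (proj₁ B) i j) → position A ≡ position B
    position-cong A B A≈B = ≡.cong₂ _,_
      (K.from-cong (∧-cong {y = w′} {w′} (*ᵥ-cong u′ A≈B) (λ _ → refl)))
      (punchOut-cong (K.from 0#) (K.from-cong (∧-cong {w} {w} (λ _ → refl) (*ᵥ-cong u′ A≈B))))

    elementAt : Fin (suc m) × Fin m → ∃ Member
    elementAt p@(i , j) = det≉0⇒GL (matrixAt p) (matrixAt-det p) , lift (interpolate-u _)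

    matrixAt-position : ∀ A i j → matrixAt (position A) i j ≈ proj₁ (proj₁ A) i j
    matrixAt-position A = interpolate-unique (proj₁ (proj₁ A)) (lower (proj₂ A)) λ i → begin
      z i
        ≈⟨ coordinates z i ⟨
      (z ∧ w′) * w i + (w ∧ z) * w′ i
        ≈⟨ +-cong (*-congʳ (K.strictlyInverseˡ _)) (*-congʳ
             (trans (reflexive (≡.cong K.to (punchIn-punchOut (from≢0 (w∧image≉0 A))))) (K.strictlyInverseˡ _))) ⟨
      (K.to (proj₁ (position A)) w+ K.to (punchIn (K.from 0#) (proj₂ (position A))) w′) i ∎
      where
      z = proj₁ (proj₁ A) *ᵥ u′

    position-elementAt : ∀ p → position (elementAt p) ≡ p
    position-elementAt (i , j) = ≡.cong₂ _,_
      (≡.trans (K.from-cong (trans (∧-cong {y = w′} {w′} (interpolate-u′ z) (λ _ → refl)) (∧-w′ _ _))) (K.strictlyInverseʳ i))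
      (≡.trans (punchOut-cong (K.from 0#)
        (≡.trans (K.from-cong (trans (∧-cong {w} {w} (λ _ → refl) (interpolate-u′ z)) (w-∧ _ _))) (K.strictlyInverseʳ _)))
        (punchOut-punchIn (K.from 0#)))
      where
      z = K.to i w+ K.to (punchIn (K.from 0#) j) w′

    coset : Subset 2
    coset = record
      { member      = Member
      ; respects    = λ A≈B (lift Au≋w) → lift (λ i → trans (sym (*ᵥ-cong u A≈B i)) (Au≋w i))
      ; card        = suc m ℕ.* m
      ; enumeration = record
        { to        = to
        ; from      = from
        ; to-cong   = λ { ≡.refl i j → refl }
        ; from-cong = λ {A} {B} → from-cong {A} {B}
        ; inverse   =
          (λ { {A} ≡.refl i j → trans (reflexive (≡.cong (λ p → matrixAt p i j) (Pairs.strictlyInverseˡ (position A))))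
                                      (matrixAt-position A i j) }) ,
          (λ {k} {A} A≈to → ≡.trans (from-cong {A} {to k} A≈to) (≡.trans
             (≡.cong Pairs.from (position-elementAt (Pairs.to k))) (Pairs.strictlyInverseʳ k)))
        }
      }
      where
      module Pairs = Inverse (*↔× {suc m} {m})
      to : Fin (suc m ℕ.* m) → ∃ Member
      to k = elementAt (Pairs.to k)
      from : ∃ Member → Fin (suc m ℕ.* m)
      from A = Pairs.from (position A)
      from-cong : ∀ {A B : ∃ Member} → (∀ i j → proj₁ (proj₁ A) i j ≈ proj₁ (proj₁ B) i j) → from A ≡ from B
      from-cong {A} {B} A≈B = ≡.cong Pairs.from (position-cong A B A≈B)

    u≉0 : ¬ (u ≋ 0ᵥ)
    u≉0 u≋0 = 0≉1 (trans (sym (∧-zeroˡ u′ u≋0)) u∧u′≈1)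

    coset-intersecting : Intersecting coset
    coset-intersecting A B (lift Au≋w) (lift Bu≋w) = (u , u≉0) , λ i → trans (Au≋w i) (sym (Bu≋w i))

  -- Extending intersecting sets to a uniform size.

  -- The prescribed cardinality q (q - 1) does not depend on `F`, so extensions of different sets
  -- can be compared.
  Extension : Subset 2 → Set _
  Extension F = ∃ λ (H : Subset 2) → Intersecting H × card H ≡ suc m ℕ.* m × member F ⊆ member H

  extension : ∀ F → Intersecting F → Extension F
  extension F F-int = byCard (card F) (Subset.enumeration F)
    where
    byCard : ∀ n → HasCardinality (Subset.memberSetoid F) n → Extension F
    -- The empty set has no member to normalise by; the matrices fixing the first standard basis
    -- vector serve as a default.
    byCard zero F↔ = coset , coset-intersecting , ≡.refl , λ A∈F → contradiction (Inverse.from F↔ (_ , A∈F)) λ ()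
      where open Coset (1ₘ 0F) (1ₘ 1F) (1ₘ 0F) (1ₘ 1F) det-1ₘ det-1ₘ
    byCard (suc n) F↔ = fromCommonKernel (SingularFamily.commonKernel X singular singular₂)
      where
      module F = Inverse F↔
      g : Fin (suc n) → GL 2
      g k = proj₁ (F.to k)
      M X : Fin (suc n) → Matrix 2
      M k = proj₁ (g k)
      -- Translation by `M 0F` preserves differences and puts the zero matrix into the family, so
      -- each `X k` is itself a difference of members.
      X k = M k -ₘ M 0F
      difference-singular : ∀ j k → det (M j -ₘ M k) ≈ 0#
      difference-singular j k = let u , agree = F-int (g j) (g k) (proj₂ (F.to j)) (proj₂ (F.to k)) in
        agree⇒det≈0 (M j) (M k) u agree
      singular : ∀ k → det (X k) ≈ 0#
      singular k = difference-singular k 0F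
      singular₂ : ∀ j k → det (X j -ₘ X k) ≈ 0#
      singular₂ j k = trans (det-cong {X j -ₘ X k} {M j -ₘ M k} λ i l →
        solve 3 (λ a b c → (a :- c) :- (b :- c) := a :- b) refl (M j i l) (M k i l) (M 0F i l))
        (difference-singular j k)

      fromCommonKernel : (∃ λ (u : Ω 2) → ∀ k → X k *ᵥ proj₁ u ≋ 0ᵥ) ⊎
                         (∃ λ (u : Ω 2) → ∀ k → (X k) ᵀ *ᵥ proj₁ u ≋ 0ᵥ) → Extension F
      -- All members agree with `M 0F` at `u`, so the target is `M 0F *ᵥ u`, nonzero by
      -- invertibility.
      fromCommonKernel (inj₁ ((u , u≉0) , Xu≋0)) =
        coset , coset-intersecting , ≡.refl , λ {A} A∈F → let k = F.from (A , A∈F) in lift λ i → begin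
          (proj₁ A *ᵥ u) i      ≈⟨ *ᵥ-cong u (F.strictlyInverseˡ (A , A∈F)) i ⟨
          (M k *ᵥ u) i          ≈⟨ kernel⇒agree (M k) (M 0F) u (Xu≋0 k) i ⟩
          (M 0F *ᵥ u) i         ∎
        where
        u′ = complement u≉0
        w′ = complement (GL-injective (g 0F) u≉0)
        open Coset u (proj₁ u′) (M 0F *ᵥ u) (proj₁ w′) (proj₂ u′) (proj₂ w′)
      -- The same argument places the transposed members in a coset, which `ᵀˢ` carries back.
      fromCommonKernel (inj₂ ((u , u≉0) , Xᵀu≋0)) =
        coset ᵀˢ , ᵀˢ-intersecting coset coset-intersecting , ≡.refl , λ {A} A∈F → let k = F.from (A , A∈F) in lift λ i → begin
          (proj₁ A ᵀ *ᵥ u) i    ≈⟨ *ᵥ-cong u (λ j l → F.strictlyInverseˡ (A , A∈F) l j) i ⟨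
          (M k ᵀ *ᵥ u) i        ≈⟨ kernel⇒agree (M k ᵀ) (M 0F ᵀ) u (Xᵀu≋0 k) i ⟩
          (M 0F ᵀ *ᵥ u) i       ∎
        where
        u′ = complement u≉0
        w′ = complement (GL-injective (transpose (g 0F)) u≉0)
        open Coset u (proj₁ u′) (M 0F ᵀ *ᵥ u) (proj₁ w′) (proj₂ u′) (proj₂ w′)

  -- Maximality yields H ⊆ F only up to double negation, which suffices as ≤ is decidable.
  maximal⇒maximum : ∀ F → Maximal F → Maximum F
  maximal⇒maximum F (F-int , F-max) = F-int , λ G G-int →
    let H  , H-int , |H|≡ , F⊆H = extension F F-int
        H′ , _ , |H′|≡ , G⊆H′   = extension G G-int
    -- If `H` were contained in `F`, then `card G ≤ card H′ = card H ≤ card F`. So failure of the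
    -- bound makes `H` a proper intersecting extension of `F`.
    in decidable-stable (card G ≤? card F) λ G≰F → F-max (H , H-int , F⊆H , λ H⊆F → G≰F
         (≤-trans (card-mono G H′ G⊆H′) (≤-trans (≤-reflexive (≡.trans |H′|≡ (≡.sym |H|≡))) (card-mono H F H⊆F))))

corollary1p3 : ∀ {c ℓ : Level} (q : ℕ) → PrimePower q →
    (K : Field c ℓ) → HasCardinality (Field.setoid K) q →
    (F : LinearAlgebra.Subset K 2) →
    LinearAlgebra.Maximal K F → LinearAlgebra.Maximum K F
-- A field contains `0#`, so `Fin 0` cannot enumerate it.
corollary1p3 zero    _ K finite = contradiction (Inverse.from finite (Field.0# K)) λ ()
corollary1p3 (suc _) _ K finite = FinitePlane.maximal⇒maximum K finite
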